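{- Mult-factorization of any tree is unique. That is, let $T$ be a tree with $n_T>1$. If $$T=T_1\cdot T_2\cdots T_k=S_1\cdot S_2\cdots S_h$$ with $k,h\ge 1$ and all the trees $T_1,\dots,T_k,S_1,\dots,S_h$ mult-prime, then $k=h$ and $T_i=S_i$ for all $1\le i\le k$.
   Context: A "tree" is a finite non-empty rooted unordered tree; two trees are regarded as equal if they are isomorphic as rooted trees. $\mathbf{1}$ is the tree with exactly one vertex, $n_T$ is the number of vertices of $T$, and $r(T)$ is its root. The subtrees of $r(T)$ are the trees rooted at the children of $r(T)$, each consisting of a child and all its descendants. Multiplication: $A\cdot B$ is the tree obtained by merging the root of a (separate) copy of $B$ with each vertex $x\in A$, so that all the subtrees of $r(B)$ become new subtrees of $x$ (in addition to those $x$ already has in $A$). Multiplication is associative but not commutative in general, so products of several factors are written without parentheses and the order of the factors matters. A tree $T$ with $n_T>1$ is mult-prime if it can be generated by multiplication only if the factors are $\mathbf{1}$ and $T$, i.e. $T=A\cdot B$ implies that one of $A,B$ is $\mathbf{1}$ and the other is $T$. In particular mult-prime trees are different from $\mathbf{1}$. -}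

module Defs where

open import Data.List.Base using (List; []; _∷_; _++_)
open import Data.List.Relation.Binary.Permutation.Homogeneous using (Permutation)
open import Data.Nat.Base using (ℕ; suc; _+_; _<_)
open import Data.Product.Base using (_×_)
open import Data.Sum.Base using (_⊎_)
open import Data.Vec.Base using (Vec; foldr₁)

-- A vertex together with the trees rooted at its children. The order of the
-- list is an artefact of the representation and is forgotten by _≅_.
data Tree : Set where
  node : List Tree → Tree

infix 4 _≅_

-- Isomorphism of rooted trees, which plays the role of equality: the children
-- of the two roots are matched bijectively, matched children having isomorphic
-- trees of descendants.
data _≅_ : Tree → Tree → Set where
  node : ∀ {ts us} → Permutation _≅_ ts us → node ts ≅ node us

𝟏 : Tree
𝟏 = node []

mutual
  size : Tree → ℕ
  size (node ts) = suc (sizes ts)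

  sizes : List Tree → ℕ
  sizes []       = 0
  sizes (t ∷ ts) = size t + sizes ts

infixr 7 _·_ _·*_

-- A · B attaches the subtrees of the root of B to every vertex of A: at the
-- root of A they are appended, and ts ·* B (that is, map (_· B) ts, unfolded
-- for the termination checker) deals with the vertices below the root.
mutual
  _·_ : Tree → Tree → Tree
  node ts · node us = node ((ts ·* node us) ++ us)

  _·*_ : List Tree → Tree → List Tree
  []       ·* B = []
  (t ∷ ts) ·* B = (t · B) ∷ (ts ·* B)

∏ : ∀ {k} → Vec Tree (suc k) → Tree
∏ = foldr₁ _·_

MultPrime : Tree → Set
MultPrime T =
  1 < size T ×
  (∀ A B → T ≅ A · B → (A ≅ 𝟏 × B ≅ T) ⊎ (A ≅ T × B ≅ 𝟏))

{-# OPTIONS --safe #-}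
-- A vertex of A · B carries either the tree a · B, with a hanging from a vertex
-- of A, or a tree smaller than B; and the vertices of C · D coming from leaves
-- of C carry D. Hence if A · B ≅ C · D and B is not larger than D, then D ≅ E · B
-- for some E. If B and D are mult-prime this forces B ≅ D, and the last factors
-- of two factorizations can be cancelled.
module Submission where

open import Data.Fin.Base using (Fin; zero; suc; cast)
open import Data.List.Base using (List; []; _∷_; _++_; map; foldl; foldr; reverse)
open import Data.List.Membership.Propositional using (find)
open import Data.List.Membership.Propositional.Properties using (∈-∃++)
open import Data.List.Properties
  using (++-assoc; reverse-foldr; reverse-involutive)
open import Data.List.Relation.Binary.Permutation.Homogeneous
  using (Permutation; refl; prep; swap; trans)
import Data.List.Relation.Binary.Permutation.Setoid.Properties as PermutationProperties
open import Data.List.Relation.Binary.Pointwise as Pointwise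
  using (Pointwise; []; _∷_)
open import Data.List.Relation.Unary.All as All using (All; []; _∷_)
open import Data.List.Relation.Unary.Any using (Any; here; there)
open import Data.List.Relation.Unary.Any.Properties using (++⁻; map⁻; reverse⁻)
open import Data.Nat.Base using (ℕ; suc; _+_; _≤_; _<_; s≤s)
open import Data.Nat.Properties
  using (+-assoc; +-comm; ≤-reflexive; ≤-trans; ≤-total; m≤m+n;
         m≤n+m; m≤n⇒m≤1+n; <⇒≱)
open import Data.Product.Base using (Σ; ∃; _,_)
open import Data.Sum.Base using (_⊎_; inj₁; inj₂)
open import Data.Vec.Base using (Vec; []; _∷_; lookup; toList)
import Data.Vec.Relation.Unary.All.Properties as VecAll
open import Level using (0ℓ)
open import Relation.Binary.Bundles using (Setoid)
open import Relation.Binary.PropositionalEquality as ≡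
  using (_≡_; refl; sym; cong; cong₂; subst; subst₂; module ≡-Reasoning)
open import Relation.Nullary.Negation using (¬_; contradiction)
open import Defs

private
  variable
    A B C D T U P Q : Tree
    ts us : List Tree

-- Isomorphism as an equivalence relation, and invariance of size.

mutual
  ≅-refl : T ≅ T
  ≅-refl {node ts} = node (refl ≅*-refl)

  ≅*-refl : Pointwise _≅_ ts ts
  ≅*-refl {[]}     = []
  ≅*-refl {t ∷ ts} = ≅-refl ∷ ≅*-refl

mutual
  ≅-sym : T ≅ U → U ≅ T
  ≅-sym (node p) = node (↭-sym p)

  ↭-sym : Permutation _≅_ ts us → Permutation _≅_ us ts
  ↭-sym (refl ps)    = refl (≅*-sym ps)
  ↭-sym (prep e p)   = prep (≅-sym e) (↭-sym p)
  ↭-sym (swap e f p) = swap (≅-sym f) (≅-sym e) (↭-sym p)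
  ↭-sym (trans p q)  = trans (↭-sym q) (↭-sym p)

  ≅*-sym : Pointwise _≅_ ts us → Pointwise _≅_ us ts
  ≅*-sym []       = []
  ≅*-sym (e ∷ es) = ≅-sym e ∷ ≅*-sym es

-- Immediate, since `trans` is itself a constructor of `Permutation`.
≅-trans : A ≅ B → B ≅ C → A ≅ C
≅-trans (node p) (node q) = node (trans p q)

≅-setoid : Setoid 0ℓ 0ℓ
≅-setoid = record
  { Carrier       = Tree
  ; _≈_           = _≅_
  ; isEquivalence = record { refl = ≅-refl ; sym = ≅-sym ; trans = ≅-trans }
  }

open PermutationProperties ≅-setoid
  using (++-comm; ++⁺; dropMiddle; dropMiddleElement; ¬x∷xs↭[]; ∈-resp-↭; ↭-shift)

mutual
  size-cong : T ≅ U → size T ≡ size U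
  size-cong (node p) = cong suc (sizes-cong-↭ p)

  sizes-cong-↭ : Permutation _≅_ ts us → sizes ts ≡ sizes us
  sizes-cong-↭ (refl es)   = sizes-cong es
  sizes-cong-↭ (prep e p)  = cong₂ _+_ (size-cong e) (sizes-cong-↭ p)
  sizes-cong-↭ (trans p q) = ≡.trans (sizes-cong-↭ p) (sizes-cong-↭ q)
  sizes-cong-↭ (swap {xs} {ys} {x} {y} {x′} {y′} e f p) = begin
    size x + (size y + sizes xs)     ≡⟨ cong₂ _+_ (size-cong e)
                                          (cong₂ _+_ (size-cong f) (sizes-cong-↭ p)) ⟩
    size x′ + (size y′ + sizes ys)   ≡⟨ +-assoc (size x′) (size y′) _ ⟨
    (size x′ + size y′) + sizes ys   ≡⟨ cong (_+ sizes ys) (+-comm (size x′) (size y′)) ⟩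
    (size y′ + size x′) + sizes ys   ≡⟨ +-assoc (size y′) (size x′) _ ⟩
    size y′ + (size x′ + sizes ys)   ∎
    where open ≡-Reasoning

  sizes-cong : Pointwise _≅_ ts us → sizes ts ≡ sizes us
  sizes-cong []       = refl
  sizes-cong (e ∷ es) = cong₂ _+_ (size-cong e) (sizes-cong es)

-- Algebraic laws of the product.

·*-≡-map : ∀ ts B → ts ·* B ≡ map (_· B) ts
·*-≡-map []       B = refl
·*-≡-map (t ∷ ts) B = cong (t · B ∷_) (·*-≡-map ts B)

·*-++ : ∀ ts us B → (ts ++ us) ·* B ≡ (ts ·* B) ++ (us ·* B)
·*-++ []       us B = refl
·*-++ (t ∷ ts) us B = cong (t · B ∷_) (·*-++ ts us B)

·-identityˡ : ∀ T → 𝟏 · T ≡ T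
·-identityˡ (node ts) = refl

mutual
  -- Both bracketings list the children in the same order at every vertex, so the law holds as `≡`
  -- and not just up to `_≅_`.
  ·-assoc : ∀ A B C → (A · B) · C ≡ A · (B · C)
  ·-assoc (node ts) B@(node us) C@(node vs) = cong node (begin
    ((ts ·* B) ++ us) ·* C ++ vs              ≡⟨ cong (_++ vs) (·*-++ (ts ·* B) us C) ⟩
    (((ts ·* B) ·* C) ++ (us ·* C)) ++ vs     ≡⟨ ++-assoc ((ts ·* B) ·* C) _ vs ⟩
    ((ts ·* B) ·* C) ++ ((us ·* C) ++ vs)     ≡⟨ cong (_++ ((us ·* C) ++ vs)) (·*-assoc ts B C) ⟩
    (ts ·* (B · C)) ++ ((us ·* C) ++ vs)      ∎)
    where open ≡-Reasoning

  ·*-assoc : ∀ ts B C → (ts ·* B) ·* C ≡ ts ·* (B · C)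
  ·*-assoc []       B C = refl
  ·*-assoc (t ∷ ts) B C = cong₂ _∷_ (·-assoc t B C) (·*-assoc ts B C)

mutual
  ·-congˡ : ∀ A → B ≅ C → A · B ≅ A · C
  ·-congˡ (node ts) e@(node p) = node (++⁺ (refl (·*-congˡ ts e)) p)

  ·*-congˡ : ∀ ts → B ≅ C → Pointwise _≅_ (ts ·* B) (ts ·* C)
  ·*-congˡ []       e = []
  ·*-congˡ (t ∷ ts) e = ·-congˡ t e ∷ ·*-congˡ ts e

-- Right cancellation.

mutual
  ·-cancelʳ : ∀ A C B → A · B ≅ C · B → A ≅ C
  ·-cancelʳ (node ts) (node us) (node vs) (node p) =
    node (·*-cancelʳ ts us (node vs)
      -- The children `vs` of the root of the common factor are moved to the front on both sides and
      -- cancelled there.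
      (dropMiddle [] [] (trans (++-comm vs _) (trans p (++-comm _ vs)))))

  -- Induction on `ts`: the head `t · B` is matched with some `u · B`, cancellation for the smaller
  -- tree `t` gives `t ≅ u`, and both entries are removed.
  ·*-cancelʳ : ∀ ts us B → Permutation _≅_ (ts ·* B) (us ·* B) → Permutation _≅_ ts us
  ·*-cancelʳ []       []       B p = refl []
  ·*-cancelʳ []       (u ∷ us) B p = contradiction (↭-sym p) ¬x∷xs↭[]
  ·*-cancelʳ (t ∷ ts) us       B p
    with find (map⁻ (subst (Any (t · B ≅_)) (·*-≡-map us B)
                       (∈-resp-↭ p (here ≅-refl))))
  ... | u , u∈us , tB≅uB with ∈-∃++ u∈us
  ... | us₁ , us₂ , refl =
    trans (prep (·-cancelʳ t u B tB≅uB) (·*-cancelʳ ts (us₁ ++ us₂) B rest))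
          (↭-sym (↭-shift us₁ us₂))
    where
    rest : Permutation _≅_ (ts ·* B) ((us₁ ++ us₂) ·* B)
    -- The head `t · B` is first exchanged for `u · B`, so that literally the same entry is dropped
    -- from both lists.
    rest rewrite ·*-++ us₁ us₂ B = dropMiddleElement [] (us₁ ·* B)
      (trans (prep (≅-sym tB≅uB) (refl ≅*-refl))
             (subst (Permutation _≅_ (t · B ∷ ts ·* B)) (·*-++ us₁ (u ∷ us₂) B) p))

-- Trees of descendants inside a product.

infix 4 _≼_

-- Some vertex of the right-hand tree has, together with all its descendants, a tree isomorphic to
-- `D`; this is stronger than an embedding.
data _≼_ (D : Tree) : Tree → Set where
  root  : D ≅ T → D ≼ T
  below : Any (D ≼_) ts → D ≼ node ts

mutual
  ≼-respʳ : T ≅ U → D ≼ T → D ≼ U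
  ≼-respʳ e        (root D≅T) = root (≅-trans D≅T e)
  ≼-respʳ (node p) (below D∈) = below (Any-≼-resp-↭ p D∈)

  Any-≼-resp-↭ : Permutation _≅_ ts us → Any (D ≼_) ts → Any (D ≼_) us
  Any-≼-resp-↭ (refl es)    a                 = Any-≼-resp es a
  Any-≼-resp-↭ (prep e p)   (here d)          = here (≼-respʳ e d)
  Any-≼-resp-↭ (prep e p)   (there a)         = there (Any-≼-resp-↭ p a)
  Any-≼-resp-↭ (swap e f p) (here d)          = there (here (≼-respʳ e d))
  Any-≼-resp-↭ (swap e f p) (there (here d))  = here (≼-respʳ f d)
  Any-≼-resp-↭ (swap e f p) (there (there a)) = there (there (Any-≼-resp-↭ p a))
  Any-≼-resp-↭ (trans p q)  a                 = Any-≼-resp-↭ q (Any-≼-resp-↭ p a)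

  Any-≼-resp : Pointwise _≅_ ts us → Any (D ≼_) ts → Any (D ≼_) us
  Any-≼-resp (e ∷ es) (here d)  = here (≼-respʳ e d)
  Any-≼-resp (e ∷ es) (there a) = there (Any-≼-resp es a)

mutual
  ≼⇒size≤ : D ≼ T → size D ≤ size T
  ≼⇒size≤ (root D≅T) = ≤-reflexive (size-cong D≅T)
  ≼⇒size≤ (below a)  = m≤n⇒m≤1+n (Any-≼⇒size≤ a)

  Any-≼⇒size≤ : Any (D ≼_) ts → size D ≤ sizes ts
  Any-≼⇒size≤ (here d)  = ≤-trans (≼⇒size≤ d) (m≤m+n _ _)
  Any-≼⇒size≤ (there a) = ≤-trans (Any-≼⇒size≤ a) (m≤n+m _ _)

-- Following first children in `C` ends at a leaf, which has no subtrees of its own and so carries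
-- exactly `D`.
≼-·ˡ : ∀ C D → D ≼ C · D
≼-·ˡ (node [])       (node us) = root ≅-refl
≼-·ˡ (node (t ∷ ts)) (node us) = below (here (≼-·ˡ t (node us)))

mutual
  ≼-·⁻ : ∀ A B → D ≼ A · B → (∃ λ E → D ≅ E · B) ⊎ size D < size B
  ≼-·⁻ (node ts) (node us) (root D≅AB) = inj₁ (node ts , D≅AB)
  ≼-·⁻ (node ts) (node us) (below a) with ++⁻ (ts ·* node us) a
  ... | inj₁ a′ = ≼-·*⁻ ts (node us) a′
  -- Here `D` lies strictly below the root of the attached copy of `node us`; that root makes the
  -- inequality strict.
  ... | inj₂ a′ = inj₂ (s≤s (Any-≼⇒size≤ a′))

  ≼-·*⁻ : ∀ ts B → Any (D ≼_) (ts ·* B) → (∃ λ E → D ≅ E · B) ⊎ size D < size B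
  ≼-·*⁻ (t ∷ ts) B (here d)  = ≼-·⁻ t B d
  ≼-·*⁻ (t ∷ ts) B (there a) = ≼-·*⁻ ts B a

-- Last factors and uniqueness of the factorization.

right-divides : ∀ A B C D → A · B ≅ C · D → size B ≤ size D → ∃ λ E → D ≅ E · B
right-divides A B C D e B≤D with ≼-·⁻ A B (≼-respʳ (≅-sym e) (≼-·ˡ C D))
... | inj₁ D≅EB = D≅EB
... | inj₂ D<B  = contradiction B≤D (<⇒≱ D<B)

prime-≇-𝟏 : MultPrime P → ¬ P ≅ 𝟏
prime-≇-𝟏 (1<P , _) P≅𝟏 = contradiction (≤-reflexive (size-cong P≅𝟏)) (<⇒≱ 1<P)

primes-≅-if-size≤ : MultPrime P → MultPrime Q → A · P ≅ C · Q → size P ≤ size Q → P ≅ Q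
primes-≅-if-size≤ {P} {Q} {A} {C} pP (_ , factors) e P≤Q
  with right-divides A P C Q e P≤Q
... | E , Q≅EP with factors E P Q≅EP
... | inj₁ (_ , P≅Q) = P≅Q
... | inj₂ (_ , P≅𝟏) = contradiction P≅𝟏 (prime-≇-𝟏 pP)

last-factors-≅ : MultPrime P → MultPrime Q → A · P ≅ C · Q → P ≅ Q
last-factors-≅ {P} {Q} pP pQ e with ≤-total (size P) (size Q)
... | inj₁ P≤Q = primes-≅-if-size≤ pP pQ e P≤Q
... | inj₂ Q≤P = ≅-sym (primes-≅-if-size≤ pQ pP (≅-sym e) Q≤P)

-- `P` hangs from a leaf of `A`, so the product has at least `size P` vertices.
·-prime-≇-𝟏 : ∀ A → MultPrime P → ¬ A · P ≅ 𝟏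
·-prime-≇-𝟏 {P} A (1<P , _) AP≅𝟏 = contradiction
  (≤-trans (≼⇒size≤ (≼-·ˡ A P)) (≤-reflexive (size-cong AP≅𝟏))) (<⇒≱ 1<P)

-- The list holds the factors in reverse order, so that its head is the last factor.
∏ʳ : List Tree → Tree
∏ʳ = foldr (λ t A → A · t) 𝟏

∏ʳ-unique : All MultPrime ts → All MultPrime us → ∏ʳ ts ≅ ∏ʳ us → Pointwise _≅_ ts us
∏ʳ-unique []         []         e = []
∏ʳ-unique []         (pu ∷ pus) e = contradiction (≅-sym e) (·-prime-≇-𝟏 _ pu)
∏ʳ-unique (pt ∷ pts) []         e = contradiction e (·-prime-≇-𝟏 _ pt)
∏ʳ-unique {t ∷ ts} {u ∷ us} (pt ∷ pts) (pu ∷ pus) e =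
  t≅u ∷ ∏ʳ-unique pts pus
          -- Replacing `u` by `t` on the right gives both products the same last factor, as
          -- cancellation requires.
          (·-cancelʳ _ _ t (≅-trans e (·-congˡ (∏ʳ us) (≅-sym t≅u))))
  where
  t≅u : t ≅ u
  t≅u = last-factors-≅ {A = ∏ʳ ts} {C = ∏ʳ us} pt pu e

-- Passes from the left-nested bracketing, which exposes the last factor, to the right-nested one of
-- `∏`.
foldl-·-∏ : ∀ {k} A (Ts : Vec Tree (suc k)) → foldl _·_ A (toList Ts) ≡ A · ∏ Ts
foldl-·-∏ A (T ∷ [])     = refl
foldl-·-∏ A (T ∷ U ∷ Ts) = ≡.trans (foldl-·-∏ (A · T) (U ∷ Ts)) (·-assoc A T _)

∏ʳ-reverse : ∀ {k} (Ts : Vec Tree (suc k)) → ∏ʳ (reverse (toList Ts)) ≡ ∏ Ts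
∏ʳ-reverse Ts = begin
  ∏ʳ (reverse (toList Ts))  ≡⟨ reverse-foldr _ 𝟏 (toList Ts) ⟩
  foldl _·_ 𝟏 (toList Ts)   ≡⟨ foldl-·-∏ 𝟏 Ts ⟩
  𝟏 · ∏ Ts                  ≡⟨ ·-identityˡ (∏ Ts) ⟩
  ∏ Ts                      ∎
  where open ≡-Reasoning

Pointwise-toList⇒lookup : ∀ {m n} (Ts : Vec Tree m) (Ss : Vec Tree n) →
  Pointwise _≅_ (toList Ts) (toList Ss) →
  Σ (m ≡ n) λ m≡n → ∀ i → lookup Ts i ≅ lookup Ss (cast m≡n i)
Pointwise-toList⇒lookup []       []       []       = refl , λ ()
Pointwise-toList⇒lookup (T ∷ Ts) (S ∷ Ss) (e ∷ es)
  with Pointwise-toList⇒lookup Ts Ss es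
... | m≡n , es′ = cong suc m≡n , λ { zero → e ; (suc i) → es′ i }

proposition13 : ∀ (T : Tree) → 1 < size T →
    ∀ (k h : ℕ) (Ts : Vec Tree (suc k)) (Ss : Vec Tree (suc h)) →
    (∀ i → MultPrime (lookup Ts i)) →
    (∀ j → MultPrime (lookup Ss j)) →
    T ≅ ∏ Ts → T ≅ ∏ Ss →
    Σ (suc k ≡ suc h) λ k≡h →
    ∀ (i : Fin (suc k)) → lookup Ts i ≅ lookup Ss (cast k≡h i)
proposition13 T 1<T k h Ts Ss pTs pSs T≅∏Ts T≅∏Ss =
  Pointwise-toList⇒lookup Ts Ss
    -- Uniqueness is obtained for the reversed lists; a second reversal restores the order of the
    -- factors.
    (subst₂ (Pointwise _≅_) (reverse-involutive _) (reverse-involutive _)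
      (Pointwise.reverse⁺ (∏ʳ-unique (primes Ts pTs) (primes Ss pSs)
        (subst₂ _≅_ (sym (∏ʳ-reverse Ts)) (sym (∏ʳ-reverse Ss))
          (≅-trans (≅-sym T≅∏Ts) T≅∏Ss)))))
  where
  primes : ∀ {n} (Us : Vec Tree n) → (∀ i → MultPrime (lookup Us i)) →
           All MultPrime (reverse (toList Us))
  primes Us pUs = All.tabulate λ U∈ →
    All.lookup (VecAll.toList⁺ (VecAll.lookup⁻ {P = MultPrime} {xs = Us} pUs)) (reverse⁻ U∈)
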